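{- For every odd positive integer $x$ there exist integers $i\ge1$ and $m\ge1$ with the following property. Let $w$ be the binary string obtained from $s_i^m$ by deleting its leading zeros. Then the binary representation of $x$ (without leading zeros) is a prefix of $w$.
   Context: For $i\ge1$, the binary expansion of $1/3^i$ is purely periodic with period $2\cdot 3^{i-1}$. The seed $s_i$ of order $i$ is its repetend: the binary string of length $2\cdot3^{i-1}$ such that $1/3^i=0.s_is_is_i\dots$ in binary. For $m\ge1$, $s_i^m$ denotes the concatenation of $m$ copies of $s_i$ (a power of the seed). -}

module Defs where

open import Data.Nat using (ℕ; zero; suc; _+_; _*_; _∸_; _^_; _≤ᵇ_)
open import Data.Bool using (Bool; true; false; if_then_else_)
open import Data.List using (List; []; _∷_; _++_; concat; replicate)

-- Bits are Booleans: true = 1, false = 0. Strings are listed most significant bit first.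

-- binDigits q r k : the first k binary digits (after the binary point) of r / q,
-- for 0 ≤ r < q, by long division: with r < q, 2r < 2q, so the next digit
-- is 1 iff q ≤ 2r, and the new remainder is 2r - q resp. 2r.
binDigits : (q r k : ℕ) → List Bool
binDigits q r zero = []
binDigits q r (suc k) =
  if q ≤ᵇ 2 * r
  then true  ∷ binDigits q (2 * r ∸ q) k
  else false ∷ binDigits q (2 * r) k

-- period of 1/3^i for i ≥ 1 : 2 · 3^(i-1)
period : ℕ → ℕ
period i = 2 * 3 ^ (i ∸ 1)

-- seed s_i : the repetend of 1/3^i, i.e. its first 2·3^(i-1) binary digits
-- (the expansion is purely periodic with that period).
seed : ℕ → List Bool
seed i = binDigits (3 ^ i) 1 (period i)

seedPow : ℕ → ℕ → List Bool
seedPow i m = concat (replicate m (seed i))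

dropLeadingZeros : List Bool → List Bool
dropLeadingZeros [] = []
dropLeadingZeros (false ∷ bs) = dropLeadingZeros bs
dropLeadingZeros (true ∷ bs) = true ∷ bs

-- binary representation of n, least significant bit first, no trailing zeros
-- (structural recursion via fuel n, which suffices since halving n ≥ 1 takes < n steps)
private
  toBitsLSB : (fuel n : ℕ) → List Bool
  toBitsLSB zero n = []
  toBitsLSB (suc f) zero = []
  toBitsLSB (suc f) (suc n) = bit (suc n) ∷ toBitsLSB f (half (suc n))
    where
    bit : ℕ → Bool
    bit zero = false
    bit (suc zero) = true
    bit (suc (suc k)) = bit k
    half : ℕ → ℕ
    half zero = zero
    half (suc zero) = zero
    half (suc (suc k)) = suc (half k)

  rev : List Bool → List Bool
  rev [] = []
  rev (b ∷ bs) = rev bs ++ (b ∷ [])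

-- binary representation of n without leading zeros, most significant bit first
-- (empty list for n = 0)
toBinary : ℕ → List Bool
toBinary n = rev (toBitsLSB n n)

{-# OPTIONS --safe #-}
-- 1/3^i has x as its leading binary digits as soon as x·3^i ≤ 2^j < (x+1)·3^i
-- for some j: then x = ⌊2^j/3^i⌋ is spelled by the first j digits. Among
-- the values ⌊x·3^b/2^⌊log₂ 3^b⌋⌋ ∈ [x, 2x) for b = 0, …, 2x two agree, and this gives
-- a ratio of a power of 2 and a power of 3 that lies within a factor (x+1)/x of 1,
-- and differs from 1 by parity. Multiplying repeatedly by this ratio moves 2^j/3^i in
-- steps too short to jump over [x, x+1), from below or from above. Starting
-- at i ≥ 3 + x forces j ≤ 2·3^(i-1), so a single copy of the seed suffices.

module Submission where

open import Algebra.Bundles using (Monoid)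
open import Data.Bool using (Bool; true; false)
open import Data.Fin using (Fin; toℕ; fromℕ<)
open import Data.Fin.Properties using (pigeonhole; fromℕ<-injective)
open import Data.List using (List; []; _∷_; _++_)
open import Data.List.Properties using (++-assoc; ++-identityʳ)
open import Data.List.Relation.Binary.Pointwise as Pointwise using ()
open import Data.List.Relation.Binary.Prefix.Heterogeneous using (Prefix; _++ᵖ_)
open import Data.List.Relation.Binary.Prefix.Heterogeneous.Properties using (fromPointwise)
open import Data.Nat using (ℕ; zero; suc; _+_; _*_; _∸_; _^_; _≤_; _<_; _<?_; _≤ᵇ_; z≤n; s≤s; z<s; NonZero; _/_; >-nonZero)
open import Data.Nat.DivMod using (m/n*n≤m; m≡m%n+[m/n]*n; m%n<n)
open import Data.Nat.Properties
open import Data.Nat.Tactic.RingSolver using (solve-∀)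
open import Data.Product using (Σ; ∃; _×_; _,_; ∃₂; proj₁; proj₂)
open import Defs
open import Level using (0ℓ)
open import Relation.Binary.Definitions using (tri<; tri≈; tri>)
open import Relation.Binary.PropositionalEquality using (_≡_; _≢_; refl; sym; trans; cong; cong₂; subst; subst₂; module ≡-Reasoning)
open import Relation.Nullary using (¬_; yes; no; contradiction)
open import Relation.Nullary.Reflects using (ofʸ; ofⁿ)
open import Relation.Unary using (Decidable)
open import Tactic.Cong using (cong!)
open import Tactic.MonoidSolver using (solve)

-- Access to the recursion behind `toBinary`

-- The helpers of toBinary are private to Defs, so they cannot be named here. They
-- are recovered as solutions of metavariables. The monoid solver normalises
-- its goal and applies the right identity law to every maximal subterm that is
-- not itself a concatenation; in a monoid whose "equality proofs" merely record
-- these subterms, the solver's answer for toBinary n ≡ toBinary n lists them.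
record Trace (xs ys : List Bool) : Set where
  constructor trace
  field atoms : List (List Bool)
open Trace

traceMonoid : Monoid 0ℓ 0ℓ
traceMonoid = record
  { Carrier = List Bool
  ; _≈_ = Trace
  ; _∙_ = _++_
  ; ε = []
  ; isMonoid = record
    { isSemigroup = record
      { isMagma = record
        { isEquivalence = record
          { refl = trace []
          ; sym = λ t → trace (atoms t)
          ; trans = λ t u → trace (atoms t ++ atoms u) }
        ; ∙-cong = λ t u → trace (atoms t ++ atoms u) }
      ; assoc = λ _ _ _ → trace [] }
    ; identity = (λ _ → trace []) , (λ xs → trace (xs ∷ [])) } }

traceBinary : ∀ n → Trace (toBinary n) (toBinary n)
traceBinary n = solve traceMonoid

traceBinary-suc : ∀ n → Trace (toBinary (suc n)) (toBinary (suc n))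
traceBinary-suc n = solve traceMonoid

-- initBits n is rev (toBitsLSB n (half (suc n))).
mutual
  initBits : ℕ → List Bool
  initBits n = _

  initBits-captured : ∀ n → atoms (traceBinary-suc n) ≡ initBits n ∷ _
  initBits-captured n = refl

-- The three arguments serve only to guide unification: the traces fix `L` and `R`, the congruence
-- fixes `a` and `b`, and the solution `b` is returned.
difference : {L R : ℕ → List Bool} {a b : ℕ → ℕ} →
  (∀ n → ∃ λ xss → atoms (traceBinary n) ≡ L n ∷ xss) →
  (∀ n → ∃ λ xss → atoms (traceBinary-suc n) ≡ R n ∷ xss) →
  (∀ n → a n ≡ b n → L n ≡ R n) → ℕ → ℕ
difference {b = b} _ _ _ = b

-- cong! finds where rev (toBitsLSB n n) and rev (toBitsLSB n (half (suc n)))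
-- differ, so ⌈ n /2⌉′ is half (suc n).
⌈_/2⌉′ : ℕ → ℕ
⌈_/2⌉′ = difference (λ n → _ , refl) (λ n → _ , refl) (λ n eq → cong! eq)

data Expose : List Bool → Set where
  expose : ∀ xs → Expose xs

-- Abstracting half (suc n) from initBits n makes the fuel and the number
-- independent variables: bits f n is rev (toBitsLSB f n).
mutual
  bits : ℕ → ℕ → List Bool
  bits f n = _

  bits-captured : ∀ n → Expose (initBits n)
  bits-captured n with ⌈ n /2⌉′
  ... | h = expose (bits n h)

mutual
  -- The metavariable is solved by the last bit of `suc n`, which is set exactly when `n` is even;
  -- hence the name.
  isEven : ℕ → Bool
  isEven n = _

  isEven-captured : ∀ n → toBinary (suc n) ≡ initBits n ++ isEven n ∷ []
  isEven-captured n = refl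

-- Appending a binary digit

⌈n/2⌉′≤n : ∀ n → ⌈ n /2⌉′ ≤ n
⌈n/2⌉′≤n 0 = z≤n
⌈n/2⌉′≤n 1 = s≤s z≤n
⌈n/2⌉′≤n (suc (suc n)) = s≤s (m≤n⇒m≤1+n (⌈n/2⌉′≤n n))

⌈2*n/2⌉′ : ∀ n → ⌈ 2 * n /2⌉′ ≡ n
⌈2*n/2⌉′ zero = refl
⌈2*n/2⌉′ (suc n) = trans (cong ⌈_/2⌉′ (*-suc 2 n)) (cong suc (⌈2*n/2⌉′ n))

⌈1+2*n/2⌉′ : ∀ n → ⌈ suc (2 * n) /2⌉′ ≡ suc n
⌈1+2*n/2⌉′ zero = refl
⌈1+2*n/2⌉′ (suc n) = trans (cong (λ m → ⌈ suc m /2⌉′) (*-suc 2 n)) (cong suc (⌈1+2*n/2⌉′ n))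

isEven-2*n : ∀ n → isEven (2 * n) ≡ true
isEven-2*n zero = refl
isEven-2*n (suc n) = trans (cong isEven (*-suc 2 n)) (isEven-2*n n)

isEven-1+2*n : ∀ n → isEven (suc (2 * n)) ≡ false
isEven-1+2*n zero = refl
isEven-1+2*n (suc n) = trans (cong (λ m → isEven (suc m)) (*-suc 2 n)) (isEven-1+2*n n)

-- Fuel that bounds the number still bounds it after one step, since fuel drops by one and `suc n`
-- is halved to at most `n`.
bits-fuel : ∀ {n f g} → n ≤ f → n ≤ g → bits f n ≡ bits g n
bits-fuel {zero} {zero} {zero} _ _ = refl
bits-fuel {zero} {zero} {suc g} _ _ = refl
bits-fuel {zero} {suc f} {zero} _ _ = refl
bits-fuel {zero} {suc f} {suc g} _ _ = refl
bits-fuel {suc n} (s≤s n≤f) (s≤s n≤g) = cong (_++ isEven n ∷ [])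
  (bits-fuel (≤-trans (⌈n/2⌉′≤n n) n≤f) (≤-trans (⌈n/2⌉′≤n n) n≤g))

toBinary-1+2* : ∀ n → toBinary (suc (2 * n)) ≡ toBinary n ++ true ∷ []
toBinary-1+2* n = begin
  bits (2 * n) ⌈ 2 * n /2⌉′ ++ isEven (2 * n) ∷ [] ≡⟨ cong₂ (λ h b → bits (2 * n) h ++ b ∷ []) (⌈2*n/2⌉′ n) (isEven-2*n n) ⟩
  bits (2 * n) n ++ true ∷ []                      ≡⟨ cong (_++ true ∷ []) (bits-fuel (m≤m+n n _) ≤-refl) ⟩
  toBinary n ++ true ∷ []                          ∎
  where open ≡-Reasoning

toBinary-2* : ∀ n → 0 < n → toBinary (2 * n) ≡ toBinary n ++ false ∷ []
toBinary-2* (suc n) _ = begin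
  toBinary (2 * suc n)
    ≡⟨ cong toBinary (*-suc 2 n) ⟩
  bits (suc (2 * n)) ⌈ suc (2 * n) /2⌉′ ++ isEven (suc (2 * n)) ∷ []
    ≡⟨ cong₂ (λ h b → bits (suc (2 * n)) h ++ b ∷ []) (⌈1+2*n/2⌉′ n) (isEven-1+2*n n) ⟩
  bits (suc (2 * n)) (suc n) ++ false ∷ []
    ≡⟨ cong (_++ false ∷ []) (bits-fuel (s≤s (m≤m+n n _)) ≤-refl) ⟩
  toBinary (suc n) ++ false ∷ [] ∎
  where open ≡-Reasoning

-- Long division spells the floor

record IsFloor (x n q : ℕ) : Set where
  constructor isFloor
  field
    lower : x * q ≤ n
    upper : n < suc x * q

-- One doubling passes from the power of two to the dividend, which is what one step of long
-- division does.
floor-double : ∀ {x q j n m} → 2 * n ≡ m → IsFloor x (2 ^ suc j * n) q → IsFloor x (2 ^ j * m) q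
floor-double {x} {q} {j} {n} refl = subst (λ t → IsFloor x t q) (regroup (2 ^ j) n)
  where
  regroup : ∀ p n → 2 * p * n ≡ p * (2 * n)
  regroup = solve-∀

floor-unique : ∀ {x v q r} → r < q → IsFloor x (1 * (v * q + r)) q → v ≡ x
floor-unique {x} {v} {q} {r} r<q (isFloor lo hi) = ≤-antisym
  (m<1+n⇒m≤n (*-cancelʳ-< q v (suc x) (≤-<-trans (m≤m+n (v * q) r) hi′)))
  (m<1+n⇒m≤n (*-cancelʳ-< q x (suc v) (≤-<-trans lo′ (subst (v * q + r <_) (+-comm (v * q) q) (+-monoʳ-< (v * q) r<q)))))
  where
  lo′ : x * q ≤ v * q + r
  lo′ = subst (x * q ≤_) (*-identityˡ _) lo
  hi′ : v * q + r < suc x * q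
  hi′ = subst (_< suc x * q) (*-identityˡ _) hi

carry : ∀ v q r → q ≤ 2 * r → 2 * (v * q + r) ≡ suc (2 * v) * q + (2 * r ∸ q)
carry v q r q≤2r = begin
  2 * (v * q + r)                   ≡⟨ expand v q r ⟩
  2 * v * q + 2 * r                 ≡⟨ cong (2 * v * q +_) (m+[n∸m]≡n q≤2r) ⟨
  2 * v * q + (q + (2 * r ∸ q))     ≡⟨ collect (2 * v) q _ ⟩
  suc (2 * v) * q + (2 * r ∸ q)     ∎
  where
  open ≡-Reasoning
  expand : ∀ v q r → 2 * (v * q + r) ≡ 2 * v * q + 2 * r
  expand = solve-∀
  collect : ∀ w q s → w * q + (q + s) ≡ suc w * q + s
  collect = solve-∀

no-carry : ∀ v q r → 2 * (v * q + r) ≡ 2 * v * q + 2 * r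
no-carry = solve-∀

remainder-< : ∀ {q r} → r < q → q ≤ 2 * r → 2 * r ∸ q < q
remainder-< {q} {r} r<q q≤2r = subst (2 * r ∸ q <_) (m+n∸n≡m q q)
  (∸-monoˡ-< (subst (2 * r <_) (cong (q +_) (+-identityʳ q)) (*-monoʳ-< 2 r<q)) q≤2r)

-- v is the number spelled by the digits already produced by the long division.
toBinary-++-binDigits : ∀ {q r} j l v {x} → r < q → 0 < v → IsFloor x (2 ^ j * (v * q + r)) q →
  ∃ λ zs → toBinary v ++ binDigits q r (j + l) ≡ toBinary x ++ zs
toBinary-++-binDigits zero l v r<q 0<v fl rewrite floor-unique {v = v} r<q fl = _ , refl
toBinary-++-binDigits {q} {r} (suc j) l v r<q 0<v fl with q ≤ᵇ 2 * r | ≤ᵇ-reflects-≤ q (2 * r)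
... | true | ofʸ q≤2r
  with zs , eq ← toBinary-++-binDigits j l (suc (2 * v)) (remainder-< r<q q≤2r) z<s (floor-double {j = j} (carry v q r q≤2r) fl)
  = zs , trans (sym (++-assoc (toBinary v) (true ∷ []) _)) (trans (cong (_++ _) (sym (toBinary-1+2* v))) eq)
... | false | ofⁿ q≰2r
  with zs , eq ← toBinary-++-binDigits j l (2 * v) (≰⇒> q≰2r) (*-monoʳ-< 2 0<v) (floor-double {j = j} (no-carry v q r) fl)
  = zs , trans (sym (++-assoc (toBinary v) (false ∷ []) _)) (trans (cong (_++ _) (sym (toBinary-2* v 0<v))) eq)

-- While only zeros have appeared, the number spelled so far is `0`; the first digit one hands over
-- to `toBinary-++-binDigits` with `v = 1`.
dropLeadingZeros-binDigits : ∀ {q r} j l {x} → r < q → 0 < x → IsFloor x (2 ^ j * r) q →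
  ∃ λ zs → dropLeadingZeros (binDigits q r (j + l)) ≡ toBinary x ++ zs
dropLeadingZeros-binDigits {q} {r} zero l {x} r<q 0<x fl =
  -- If all `j` digits were zero, the floor would be `0`.
  contradiction (floor-unique {x} {0} {q} r<q fl) (<⇒≢ 0<x)
dropLeadingZeros-binDigits {q} {r} (suc j) l r<q 0<x fl with q ≤ᵇ 2 * r | ≤ᵇ-reflects-≤ q (2 * r)
... | true | ofʸ q≤2r = toBinary-++-binDigits j l 1 (remainder-< r<q q≤2r) z<s (floor-double {j = j} (carry 0 q r q≤2r) fl)
... | false | ofⁿ q≰2r = dropLeadingZeros-binDigits j l (≰⇒> q≰2r) 0<x (floor-double {j = j} refl fl)

-- Growth of powers

crossing : ∀ {p} {P : ℕ → Set p} → Decidable P → ∀ n → ¬ P 0 → P n → ∃ λ k → ¬ P k × P (suc k)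
crossing P? zero ¬P0 P0 = contradiction P0 ¬P0
crossing P? (suc n) ¬P0 Pn with P? n
... | yes Pn′ = crossing P? n ¬P0 Pn′
... | no ¬Pn′ = n , ¬Pn′ , Pn

n<2^n : ∀ n → n < 2 ^ n
n<2^n zero = z<s
n<2^n (suc n) = ≤-trans (+-mono-≤ (m^n>0 2 n) (n<2^n n)) (≤-reflexive (cong (2 ^ n +_) (sym (+-identityʳ _))))

-- Bernoulli's inequality `(b/a)^n ≥ 1 + n/a`, multiplied by `a ^ suc n`.
bernoulli : ∀ {a b} → a < b → ∀ n → a ^ n * (a + n) ≤ a * b ^ n
bernoulli {a} {b} a<b zero = ≤-reflexive (base a)
  where
  base : ∀ a → 1 * (a + 0) ≡ a * 1
  base = solve-∀
bernoulli {a} {b} a<b (suc n) = begin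
  a ^ suc n * (a + suc n)            ≤⟨ m≤m+n _ (a ^ n * n) ⟩
  a ^ suc n * (a + suc n) + a ^ n * n ≡⟨ regroup a (a ^ n) n ⟩
  a ^ n * (a + n) * suc a            ≤⟨ *-mono-≤ (bernoulli a<b n) a<b ⟩
  a * b ^ n * b                      ≡⟨ assoc a (b ^ n) b ⟩
  a * b ^ suc n                      ∎
  where
  open ≤-Reasoning
  regroup : ∀ a p n → a * p * (a + suc n) + p * n ≡ p * (a + n) * suc a
  regroup = solve-∀
  assoc : ∀ a p b → a * p * b ≡ a * (b * p)
  assoc = solve-∀

powers-outgrow : ∀ {a b} → 0 < a → a < b → ∀ c → ∃ λ n → c * a ^ n < b ^ n
powers-outgrow {a} {b} 0<a a<b c = n , *-cancelˡ-< a _ _ (begin-strict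
  a * (c * a ^ n)                  <⟨ m<m+n _ (m^n>0 a (suc n)) ⟩
  a * (c * a ^ n) + a ^ suc n      ≡⟨ regroup a c (a ^ n) ⟩
  a ^ n * (a + n)                  ≤⟨ bernoulli a<b n ⟩
  a * b ^ n                        ∎)
  where
  open ≤-Reasoning
  instance _ = >-nonZero 0<a
  -- For this exponent Bernoulli gives `(b/a)^n ≥ 1 + c`.
  n = c * a
  regroup : ∀ a c p → a * (c * p) + a * p ≡ p * (a + c * a)
  regroup = solve-∀

overtaking : ∀ {a b s t} → 0 < a → a < b → 0 < s → s ≤ t →
  ∃ λ n → s * b ^ n ≤ t * a ^ n × t * a ^ suc n < s * b ^ suc n
overtaking {a} {b} {s} {t} 0<a a<b 0<s s≤t
  with N , big ← powers-outgrow 0<a a<b t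
  with n , before , after ← crossing (λ n → t * a ^ n <? s * b ^ n) N
         (≤⇒≯ (*-monoˡ-≤ 1 s≤t))
         (<-≤-trans big (m≤n*m (b ^ N) s {{>-nonZero 0<s}}))
  = n , ≮⇒≥ before , after

-- A power of two close to a power of three

powerOfTwoBelow : ∀ n → 0 < n → ∃ λ a → 2 ^ a ≤ n × n < 2 ^ suc a
powerOfTwoBelow n 0<n with a , before , after ← crossing (λ a → n <? 2 ^ a) n (≤⇒≯ 0<n) (n<2^n n) = a , ≮⇒≥ before , after

3^n-odd : ∀ n → ∃ λ k → 3 ^ n ≡ suc (2 * k)
3^n-odd zero = 0 , refl
3^n-odd (suc n) with k , eq ← 3^n-odd n = suc (3 * k) , trans (cong (3 *_) eq) (triple k)
  where
  triple : ∀ k → 3 * suc (2 * k) ≡ suc (2 * suc (3 * k))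
  triple = solve-∀

2^m≢3^1+n : ∀ m n → 2 ^ m ≢ 3 ^ suc n
2^m≢3^1+n zero n eq = <⇒≢ (*-mono-≤ {2} {3} (s≤s (s≤s z≤n)) (m^n>0 3 n)) eq
2^m≢3^1+n (suc m) n eq with k , odd ← 3^n-odd (suc n) = even≢odd (2 ^ m) k (trans eq odd)

-- Two numbers in `[m, m+1)` have ratio below `(m+1)/m`, which is at most `(x+1)/x` because `x ≤ m`.
same-floor⇒close : ∀ {x m p q p′ q′} → 0 < x → x ≤ m → 0 < q′ → IsFloor m (x * p) q → IsFloor m (x * p′) q′ →
  x * (p * q′) < suc x * (p′ * q)
same-floor⇒close {x} {m} {p} {q} {p′} {q′} 0<x x≤m 0<q′ f f′ = *-cancelˡ-< m _ _ (begin-strict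
  m * (x * (p * q′))       ≡⟨ r₁ m x p q′ ⟩
  x * p * (m * q′)         ≤⟨ *-monoʳ-≤ (x * p) (lower f′) ⟩
  x * p * (x * p′)         <⟨ *-monoˡ-< (x * p′) {{>-nonZero 0<xp′}} (upper f) ⟩
  suc m * q * (x * p′)     ≡⟨ r₂ m x q p′ ⟩
  m * x * (p′ * q) + x * (p′ * q) ≤⟨ +-monoʳ-≤ (m * x * (p′ * q)) (*-monoˡ-≤ (p′ * q) x≤m) ⟩
  m * x * (p′ * q) + m * (p′ * q) ≡⟨ r₃ m x (p′ * q) ⟩
  m * (suc x * (p′ * q))   ∎)
  where
  open ≤-Reasoning
  open IsFloor
  0<xp′ : 0 < x * p′
  0<xp′ = ≤-trans (*-mono-≤ (≤-trans 0<x x≤m) 0<q′) (lower f′)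
  r₁ : ∀ m x p q′ → m * (x * (p * q′)) ≡ x * p * (m * q′)
  r₁ = solve-∀
  r₂ : ∀ m x q p′ → suc m * q * (x * p′) ≡ m * x * (p′ * q) + x * (p′ * q)
  r₂ = solve-∀
  r₃ : ∀ m x c → m * x * c + m * c ≡ m * (suc x * c)
  r₃ = solve-∀

/-isFloor : ∀ n q .{{_ : NonZero q}} → IsFloor (n / q) n q
/-isFloor n q = isFloor (m/n*n≤m n q)
  (subst (_< suc (n / q) * q) (sym (m≡m%n+[m/n]*n n q)) (+-monoˡ-< (n / q * q) (m%n<n n q)))

2^m≤3^b∧3^b′<2^1+n⇒m≤n : ∀ {b b′ m n} → b ≤ b′ → 2 ^ m ≤ 3 ^ b → 3 ^ b′ < 2 ^ suc n → m ≤ n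
2^m≤3^b∧3^b′<2^1+n⇒m≤n b≤b′ lo hi = ≮⇒≥ λ n<m →
  <⇒≱ hi (≤-trans (^-monoʳ-≤ 2 n<m) (≤-trans lo (^-monoʳ-≤ 3 b≤b′)))

-- The common factor `3 ^ b * 2 ^ m` cancels, leaving the differences of exponents. Writing the one
-- of three as `suc d` keeps it positive, which excludes the trivial ratio `2 ^ 0 = 3 ^ 0`.
quotient-close : ∀ x {b b′ m m′} → b < b′ → m ≤ m′ →
  x * (3 ^ b * 2 ^ m′) < suc x * (3 ^ b′ * 2 ^ m) → x * (3 ^ b′ * 2 ^ m) < suc x * (3 ^ b * 2 ^ m′) →
  ∃₂ λ a d → x * 2 ^ a < suc x * 3 ^ suc d × x * 3 ^ suc d < suc x * 2 ^ a
quotient-close x {b} {m = m} b<b′ m≤m′ lt₁ lt₂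
  with d , refl ← m≤n⇒∃[o]m+o≡n b<b′ | a , refl ← m≤n⇒∃[o]m+o≡n m≤m′
  = a , d
  , *-cancelˡ-< (3 ^ b * 2 ^ m) _ _ (subst₂ _<_ (2^-part x a) (3^-part (suc x) d) lt₁)
  , *-cancelˡ-< (3 ^ b * 2 ^ m) _ _ (subst₂ _<_ (3^-part x d) (2^-part (suc x) a) lt₂)
  where
  open ≡-Reasoning
  regroup₂ : ∀ y p q r → y * (p * (q * r)) ≡ p * q * (y * r)
  regroup₂ = solve-∀
  regroup₃ : ∀ y p q r → y * (p * r * q) ≡ p * q * (y * r)
  regroup₃ = solve-∀
  2^-part : ∀ y a → y * (3 ^ b * 2 ^ (m + a)) ≡ 3 ^ b * 2 ^ m * (y * 2 ^ a)
  2^-part y a = trans (cong (λ t → y * (3 ^ b * t)) (^-distribˡ-+-* 2 m a)) (regroup₂ y (3 ^ b) (2 ^ m) (2 ^ a))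
  3^-part : ∀ y d → y * (3 ^ (suc b + d) * 2 ^ m) ≡ 3 ^ b * 2 ^ m * (y * 3 ^ suc d)
  3^-part y d = begin
    y * (3 ^ (suc b + d) * 2 ^ m)     ≡⟨ cong (λ e → y * (3 ^ e * 2 ^ m)) (+-suc b d) ⟨
    y * (3 ^ (b + suc d) * 2 ^ m)     ≡⟨ cong (λ t → y * (t * 2 ^ m)) (^-distribˡ-+-* 3 b (suc d)) ⟩
    y * (3 ^ b * 3 ^ suc d * 2 ^ m)   ≡⟨ regroup₃ y (3 ^ b) (2 ^ m) (3 ^ suc d) ⟩
    3 ^ b * 2 ^ m * (y * 3 ^ suc d)   ∎

module _ (x : ℕ) (0<x : 0 < x) where
  open IsFloor

  private
    module _ (b : ℕ) where
      log : ℕ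
      log = proj₁ (powerOfTwoBelow (3 ^ b) (m^n>0 3 b))

      log-lower : 2 ^ log ≤ 3 ^ b
      log-lower = proj₁ (proj₂ (powerOfTwoBelow (3 ^ b) (m^n>0 3 b)))

      log-upper : 3 ^ b < 2 ^ suc log
      log-upper = proj₂ (proj₂ (powerOfTwoBelow (3 ^ b) (m^n>0 3 b)))

      instance 2^log≢0 = m^n≢0 2 log

      bucket : ℕ
      bucket = x * 3 ^ b / 2 ^ log

      bucket-isFloor : IsFloor bucket (x * 3 ^ b) (2 ^ log)
      bucket-isFloor = /-isFloor (x * 3 ^ b) (2 ^ log)

      x≤bucket : x ≤ bucket
      x≤bucket = m<1+n⇒m≤n (*-cancelʳ-< (2 ^ log) x (suc bucket)
        (≤-<-trans (*-monoʳ-≤ x log-lower) (upper bucket-isFloor)))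

      bucket<2*x : bucket < 2 * x
      bucket<2*x = *-cancelʳ-< (2 ^ log) bucket (2 * x) (begin-strict
        bucket * 2 ^ log    ≤⟨ lower bucket-isFloor ⟩
        x * 3 ^ b           <⟨ *-monoʳ-< x {{>-nonZero 0<x}} log-upper ⟩
        x * (2 * 2 ^ log)   ≡⟨ *-assoc x 2 (2 ^ log) ⟨
        x * 2 * 2 ^ log     ≡⟨ cong (_* 2 ^ log) (*-comm x 2) ⟩
        2 * x * 2 ^ log     ∎)
        where open ≤-Reasoning

    same-bucket⇒close : ∀ b b′ → bucket b ≡ bucket b′ →
      x * (3 ^ b * 2 ^ log b′) < suc x * (3 ^ b′ * 2 ^ log b)
    same-bucket⇒close b b′ eq = same-floor⇒close 0<x (x≤bucket b) (m^n>0 2 (log b′)) (bucket-isFloor b)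
      (subst (λ m → IsFloor m (x * 3 ^ b′) (2 ^ log b′)) (sym eq) (bucket-isFloor b′))

    bucketFin : Fin (suc (2 * x)) → Fin (2 * x)
    bucketFin i = fromℕ< (bucket<2*x (toℕ i))

  close-powers : ∃₂ λ a d → x * 2 ^ a < suc x * 3 ^ suc d × x * 3 ^ suc d < suc x * 2 ^ a
  close-powers with i , j , i<j , eq ← pigeonhole (n<1+n (2 * x)) bucketFin =
    quotient-close x {toℕ i} {toℕ j} {log (toℕ i)} {log (toℕ j)} i<j
      (2^m≤3^b∧3^b′<2^1+n⇒m≤n {n = log (toℕ j)} (<⇒≤ i<j) (log-lower (toℕ i)) (log-upper (toℕ j)))
      (same-bucket⇒close (toℕ i) (toℕ j) bucket≡) (same-bucket⇒close (toℕ j) (toℕ i) (sym bucket≡))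
    where
    bucket≡ = fromℕ<-injective _ _ (bucket<2*x (toℕ i)) (bucket<2*x (toℕ j)) eq

-- Orbits that must enter `[x, x+1)`

module _ {x A B : ℕ} (0<x : 0 < x) (0<A : 0 < A) (A<B : A < B) (close : x * B < suc x * A) where
  open ≤-Reasoning

  -- The values `(B/A)^n / c` start at or below `x`. The step that takes them above `x` multiplies
  -- by less than `(x+1)/x`, so it ends below `x+1`.
  rising-orbit : ∀ {c} → 0 < c → ∃ λ n → IsFloor x (B ^ suc n) (c * A ^ suc n)
  rising-orbit {c} 0<c
    with n , before , after ← overtaking {s = 1} {t = x * c} 0<A A<B z<s (*-mono-≤ 0<x 0<c)
    = n , isFloor
      (begin
        x * (c * A ^ suc n)       ≡⟨ *-assoc x c _ ⟨
        x * c * A ^ suc n         ≤⟨ <⇒≤ after ⟩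
        1 * B ^ suc n             ≡⟨ *-identityˡ _ ⟩
        B ^ suc n                 ∎)
      (begin-strict
        B * B ^ n                 ≡⟨ cong (B *_) (*-identityˡ (B ^ n)) ⟨
        B * (1 * B ^ n)           ≤⟨ *-monoʳ-≤ B before ⟩
        B * (x * c * A ^ n)       ≡⟨ regroup₁ B x c (A ^ n) ⟩
        c * A ^ n * (x * B)       <⟨ *-monoʳ-< (c * A ^ n) {{>-nonZero (*-mono-≤ 0<c (m^n>0 A {{>-nonZero 0<A}} n))}} close ⟩
        c * A ^ n * (suc x * A)   ≡⟨ regroup₂ A x c (A ^ n) ⟩
        suc x * (c * A ^ suc n)   ∎)
    where
    regroup₁ : ∀ B x c p → B * (x * c * p) ≡ c * p * (x * B)
    regroup₁ = solve-∀
    regroup₂ : ∀ A x c p → c * p * (suc x * A) ≡ suc x * (c * (A * p))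
    regroup₂ = solve-∀

  -- Dually, `(t/c) (A/B)^n` starts at or above `x+1`, and the step that takes it below `x+1`
  -- shrinks it by a factor greater than `x/(x+1)`, so it stays above `x`.
  falling-orbit : ∀ {c t} → 0 < c → suc x * c ≤ t → ∃ λ n → IsFloor x (t * A ^ suc n) (c * B ^ suc n)
  falling-orbit {c} {t} 0<c start
    with n , before , after ← overtaking {s = suc x * c} {t = t} 0<A A<B (*-mono-≤ {1} {suc x} z<s 0<c) start
    = n , isFloor
      (begin
        x * (c * (B * B ^ n))       ≡⟨ regroup₁ B x c (B ^ n) ⟩
        x * B * (c * B ^ n)         ≤⟨ *-monoˡ-≤ (c * B ^ n) (<⇒≤ close) ⟩
        suc x * A * (c * B ^ n)     ≡⟨ regroup₂ A x c (B ^ n) ⟩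
        A * (suc x * c * B ^ n)     ≤⟨ *-monoʳ-≤ A before ⟩
        A * (t * A ^ n)             ≡⟨ regroup₃ A t (A ^ n) ⟩
        t * (A * A ^ n)             ∎)
      (subst (t * A ^ suc n <_) (*-assoc (suc x) c _) after)
    where
    regroup₁ : ∀ B x c p → x * (c * (B * p)) ≡ x * B * (c * p)
    regroup₁ = solve-∀
    regroup₂ : ∀ A x c p → suc x * A * (c * p) ≡ A * (suc x * c * p)
    regroup₂ = solve-∀
    regroup₃ : ∀ A t p → A * (t * p) ≡ t * (A * p)
    regroup₃ = solve-∀

shifted-power : ∀ b m n o → b ^ m * (b ^ n) ^ o ≡ b ^ (m + n * o)
shifted-power b m n o = trans (cong (b ^ m *_) (^-*-assoc b n o)) (sym (^-distribˡ-+-* b m (n * o)))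

leading-power : ∀ x → 0 < x → ∀ I → ∃₂ λ i j → I ≤ i × IsFloor x (2 ^ j) (3 ^ i)
leading-power x 0<x I =
  let a , d , 2^a≲ , 3^d≲ = close-powers x 0<x in
  from-close a (suc d) (2^m≢3^1+n a d) 2^a≲ 3^d≲
  where
  from-close : ∀ a b → 2 ^ a ≢ 3 ^ b → x * 2 ^ a < suc x * 3 ^ b → x * 3 ^ b < suc x * 2 ^ a →
    ∃₂ λ i j → I ≤ i × IsFloor x (2 ^ j) (3 ^ i)
  from-close a b 2^a≢3^b 2^a≲ 3^b≲ with <-cmp (2 ^ a) (3 ^ b)
  ... | tri≈ _ eq _ = contradiction eq 2^a≢3^b
  ... | tri> _ _ 3^b<2^a =
    -- Starting from `1 / 3 ^ I` ensures that the final exponent of three is at least `I`.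
    let n , fl = rising-orbit {x} {3 ^ b} {2 ^ a} 0<x (m^n>0 3 b) 3^b<2^a 2^a≲ (m^n>0 3 I) in
    I + b * suc n , a * suc n , m≤m+n I _
    , subst₂ (IsFloor x) (^-*-assoc 2 a (suc n)) (shifted-power 3 I b (suc n)) fl
  ... | tri< 2^a<3^b _ _ =
    -- Since `t < 2 ^ t`, the starting value `2 ^ t / 3 ^ I` exceeds `x+1`.
    let t = suc x * 3 ^ I
        n , fl = falling-orbit {x} {2 ^ a} {3 ^ b} 0<x (m^n>0 2 a) 2^a<3^b 3^b≲ (m^n>0 3 I) (<⇒≤ (n<2^n t)) in
    I + b * suc n , t + a * suc n , m≤m+n I _
    , subst₂ (IsFloor x) (shifted-power 2 t a (suc n)) (shifted-power 3 I b (suc n)) fl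

-- Fitting the digits into one period

-- From `suc x ≤ 2 ^ i` and `3 ^ i ≤ 4 ^ i` the power `2 ^ j` is below `2 ^ (3 * i)`, and `3 * i` is
-- at most the period once `i ≥ 3`.
exponent≤period : ∀ {x i j} → 3 + x ≤ i → 2 ^ j < suc x * 3 ^ i → j ≤ period i
exponent≤period {x} {suc (suc (suc e))} {j} (s≤s (s≤s (s≤s x≤e))) 2^j<[1+x]3^i = ≮⇒≥ λ period<j → <-irrefl refl (begin-strict
  2 ^ j            <⟨ 2^j<[1+x]3^i ⟩
  suc x * 3 ^ i    ≤⟨ *-mono-≤ (≤-trans (n<2^n x) (^-monoʳ-≤ 2 (m≤n⇒m≤o+n 3 x≤e))) (^-monoˡ-≤ i (n≤1+n 3)) ⟩
  2 ^ i * 4 ^ i    ≡⟨ cong (2 ^ i *_) (^-*-assoc 2 2 i) ⟩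
  2 ^ i * 2 ^ (2 * i) ≡⟨ ^-distribˡ-+-* 2 i (2 * i) ⟨
  2 ^ (3 * i)      ≤⟨ ^-monoʳ-≤ 2 (≤-trans 3i≤period (<⇒≤ period<j)) ⟩
  2 ^ j            ∎)
  where
  open ≤-Reasoning
  i = 3 + e
  e<3^e : e < 3 ^ e
  e<3^e = <-≤-trans (n<2^n e) (^-monoˡ-≤ e (n≤1+n 2))
  3i≤period : 3 * i ≤ period i
  3i≤period = begin
    3 * (3 + e)            ≤⟨ m≤m+n _ (6 + 15 * e + 3) ⟩
    3 * (3 + e) + (6 + 15 * e + 3) ≡⟨ regroup₁ e ⟩
    18 * suc e             ≤⟨ *-monoʳ-≤ 18 e<3^e ⟩
    18 * 3 ^ e             ≡⟨ regroup₂ (3 ^ e) ⟩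
    2 * (3 * (3 * 3 ^ e))  ∎
    where
    regroup₁ : ∀ e → 3 * (3 + e) + (6 + 15 * e + 3) ≡ 18 * suc e
    regroup₁ = solve-∀
    regroup₂ : ∀ p → 18 * p ≡ 2 * (3 * (3 * p))
    regroup₂ = solve-∀

theorem1 : (k : ℕ) → Σ ℕ (λ i → Σ ℕ (λ m → 1 ≤ i × 1 ≤ m × Prefix _≡_ (toBinary (2 * k + 1)) (dropLeadingZeros (seedPow i m))))
theorem1 k = from-leading-power (leading-power x 0<x (3 + x))
  where
  open IsFloor
  x = 2 * k + 1
  0<x : 0 < x
  0<x = m≤n+m 1 (2 * k)
  from-leading-power : (∃₂ λ i j → 3 + x ≤ i × IsFloor x (2 ^ j) (3 ^ i)) →
    Σ ℕ (λ i → Σ ℕ (λ m → 1 ≤ i × 1 ≤ m × Prefix _≡_ (toBinary x) (dropLeadingZeros (seedPow i m))))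
  from-leading-power (i , j , 3+x≤i , fl)
    -- The period splits into the `j` digits whose significant part spells `x` and `l` further
    -- digits.
    with l , j+l≡period ← m≤n⇒∃[o]m+o≡n (exponent≤period {x} {i} {j} 3+x≤i (upper fl))
    with zs , eq ← dropLeadingZeros-binDigits {3 ^ i} {1} j l {x}
           (^-monoʳ-< 3 (s≤s z<s) {0} {i} (≤-trans z<s 3+x≤i)) 0<x
           (subst (λ n → IsFloor x n (3 ^ i)) (sym (*-identityʳ (2 ^ j))) fl)
    = i , 1 , ≤-trans z<s 3+x≤i , ≤-refl
    , subst (Prefix _≡_ (toBinary x)) (sym (begin
        dropLeadingZeros (seedPow i 1)                ≡⟨ cong dropLeadingZeros (++-identityʳ (seed i)) ⟩
        dropLeadingZeros (seed i)                     ≡⟨ cong (λ p → dropLeadingZeros (binDigits (3 ^ i) 1 p)) j+l≡period ⟨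
        dropLeadingZeros (binDigits (3 ^ i) 1 (j + l)) ≡⟨ eq ⟩
        toBinary x ++ zs                              ∎))
        (fromPointwise (Pointwise.refl refl) ++ᵖ zs)
    where open ≡-Reasoning
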